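{- There exists a set $\mathcal C\subset\mathbb N$ whose complement $\mathbb N\setminus\mathcal C$ is infinite, such that $$\lim_{n\to\infty}\frac{\mathcal C(n)}{n}=1$$ and, for every integer $h\ge 3$, $$R_{\mathcal C,h}(n+1)>R_{\mathcal C,h}(n)\qquad\text{for all integers } n\ge 0.$$
   Context: $\mathbb N=\{0,1,2,\ldots\}$. For $A\subseteq\mathbb N$, $A(n)=\#\{a\in A: a\le n\}$ is the counting function of $A$, and for an integer $h\ge 1$, $R_{A,h}(n)=\#\{(a_1,\ldots,a_h)\in A^h: a_1+\cdots+a_h=n\}$ is the number of ordered representations of $n$ as a sum of $h$ elements of $A$. -}

module Defs where

open import Data.Integer.Base using (+_)
open import Data.List.Base using (List; [_]; length; filter; upTo; cartesianProductWith)
open import Data.Nat.Base using (ℕ; zero; suc; _≤_; NonZero)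
open import Data.Nat.Properties using (_≟_)
open import Data.Product.Base using (_×_; ∃-syntax)
open import Data.Rational.Base using (ℚ; 0ℚ; _/_; _-_; ∣_∣; _<_)
open import Data.Vec.Base using (Vec; []; _∷_; sum)
open import Data.Vec.Relation.Unary.All using (All; all?)
open import Level using (0ℓ)
open import Relation.Nullary.Decidable using (_×-dec_)
open import Relation.Unary using (Pred; Decidable)
open import Relation.Binary.PropositionalEquality using (_≡_)

Infinite : Pred ℕ 0ℓ → Set
Infinite P = ∀ m → ∃[ n ] m ≤ n × P n

-- Sequences are indexed by the positive integers, so that terms may have
-- denominator n.
HasLimit : ((n : ℕ) → .{{NonZero n}} → ℚ) → ℚ → Set
HasLimit s L =
  ∀ ε → 0ℚ < ε → ∃[ N ] (∀ n → .{{_ : NonZero n}} → N ≤ n → ∣ s n - L ∣ < ε)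

-- All h-tuples with entries drawn from a list (each listed once if the list
-- has no repetitions).
tuples : {X : Set} → (h : ℕ) → List X → List (Vec X h)
tuples zero    xs = [ [] ]
tuples (suc h) xs = cartesianProductWith _∷_ xs (tuples h xs)

-- A set A ⊆ ℕ is a predicate together with a decision procedure, which is what
-- allows the counting functions to take values in ℕ.
module _ {A : Pred ℕ 0ℓ} (A? : Decidable A) where

  -- A(n) = #{a ∈ A : a ≤ n}; upTo (suc n) lists 0, …, n.
  count : ℕ → ℕ
  count n = length (filter A? (upTo (suc n)))

  density : (n : ℕ) → .{{NonZero n}} → ℚ
  density n = + count n / n

  IsRep : (h n : ℕ) → Pred (Vec ℕ h) 0ℓ
  IsRep h n v = All A v × sum v ≡ n

  isRep? : ∀ h n → Decidable (IsRep h n)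
  isRep? h n v = all? A? v ×-dec (sum v ≟ n)

  -- It suffices to search {0,…,n}^h, since every entry of a tuple of naturals
  -- summing to n is at most n.
  R : ℕ → ℕ → ℕ
  R h n = length (filter (isRep? h n) (tuples h (upTo (suc n))))

{-# OPTIONS --safe #-}
-- Let C = ℕ \ B with B = {k(k+3) : k ≥ 1}, so that K := B(n+1)
-- satisfies K(K+3) ≤ n + 1.  Write a, b for the indicators of C, B and ⋆ for convolution.
-- For h = 3 put Q = a ⋆ a.  Since a + b = 1, taking differences in
-- a ⋆ Q + b ⋆ Q = 1 ⋆ Q gives
--   R₃(n+1) − R₃(n) = Q(n+1) − ((b ⋆ Q)(n+1) − (b ⋆ Q)(n)).
-- Here Q(n+1) ≥ n + 2 − 2K, while Q grows by at most 1 + K at each step, so the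
-- subtracted term is at most (1 + K)K; hence the difference is positive.
-- Larger h follow by induction, because convolution with a preserves strict
-- monotonicity when 0 ∈ C.
module Submission where

open import Level using (0ℓ)
open import Data.Nat.Base using (ℕ; _≤_; _<_; _+_)
open import Data.Product.Base using (Σ-syntax; _×_)
open import Data.Rational.Base using (1ℚ)
open import Relation.Unary using (Pred; Decidable; ∁)
open import Defs

open import Data.Bool.Base using (if_then_else_)
import Data.Integer.Base as ℤ
import Data.Integer.Properties as ℤₚ
open import Data.List.Base using (List; []; _∷_; _++_; length; filter; map; applyUpTo; upTo;
  cartesianProductWith)
open import Data.List.Properties using (filter-++; length-++; upTo-∷ʳ)
open import Data.Nat.Base using (zero; suc; _*_; _∸_; z≤n; s≤s; s≤s⁻¹; NonZero)
open import Data.Nat.ListAction using (sum)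
open import Data.Nat.Properties
open import Data.Nat.Tactic.RingSolver using (solve-∀)
open import Data.Product.Base using (_,_; ∃-syntax)
import Data.Rational.Base as ℚ
import Data.Rational.Properties as ℚₚ
open import Data.Rational.Unnormalised.Base as ℚᵘ using (mkℚᵘ)
import Data.Rational.Unnormalised.Properties as ℚᵘₚ
open import Data.Sum.Base using (inj₁; inj₂)
open import Data.Vec.Base as Vec using (Vec)
open import Data.Vec.Relation.Unary.All using (_∷_)
open import Function.Base using (_∘_; case_of_)
open import Relation.Binary.PropositionalEquality
open import Relation.Nullary.Decidable using (Dec; yes; no; does; ¬?)
open import Relation.Nullary.Negation using (¬_; contradiction)

-- Cumulative sums and convolutions of sequences

Seq : Set
Seq = ℕ → ℕ

cumul : Seq → Seq
cumul f zero    = f 0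
cumul f (suc n) = cumul f n + f (suc n)

infixr 7 _⋆_

-- The Cauchy product, computed by shifting the left factor, so that no truncated subtraction
-- `n ∸ i` appears.
_⋆_ : Seq → Seq → Seq
(f ⋆ g) zero    = f 0 * g 0
(f ⋆ g) (suc n) = f 0 * g (suc n) + ((f ∘ suc) ⋆ g) n

δ : Seq
δ zero    = 1
δ (suc _) = 0

cumul-suc : ∀ f n → cumul f (suc n) ≡ f 0 + cumul (f ∘ suc) n
cumul-suc f zero    = refl
cumul-suc f (suc n) = begin
  cumul f (suc n) + f (2 + n)               ≡⟨ cong (_+ f (2 + n)) (cumul-suc f n) ⟩
  f 0 + cumul (f ∘ suc) n + f (2 + n)       ≡⟨ +-assoc (f 0) _ _ ⟩
  f 0 + (cumul (f ∘ suc) n + f (2 + n))     ∎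
  where open ≡-Reasoning

cumul-complement : ∀ (f g : Seq) → (∀ i → f i + g i ≡ 1) → ∀ n → cumul f n + cumul g n ≡ suc n
cumul-complement f g f+g≡1 zero    = f+g≡1 0
cumul-complement f g f+g≡1 (suc n) = begin
  cumul f n + f (suc n) + (cumul g n + g (suc n))   ≡⟨ rearrange (cumul f n) _ _ _ ⟩
  (f (suc n) + g (suc n)) + (cumul f n + cumul g n) ≡⟨ cong₂ _+_ (f+g≡1 (suc n)) (cumul-complement f g f+g≡1 n) ⟩
  suc (suc n)                                       ∎
  where
  open ≡-Reasoning
  rearrange : ∀ p q r s → p + q + (r + s) ≡ (q + s) + (p + r)
  rearrange = solve-∀

-- Agreement is asked only up to `n`, because a count over a bounded search range is known to be
-- right only for targets below the bound.
⋆-congʳ : ∀ f {g g′ : Seq} n → (∀ i → i ≤ n → g i ≡ g′ i) → (f ⋆ g) n ≡ (f ⋆ g′) n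
⋆-congʳ f zero    g≡g′ = cong (f 0 *_) (g≡g′ 0 z≤n)
⋆-congʳ f (suc n) g≡g′ = cong₂ _+_
  (cong (f 0 *_) (g≡g′ (suc n) ≤-refl))
  (⋆-congʳ (f ∘ suc) n λ i i≤n → g≡g′ i (m≤n⇒m≤1+n i≤n))

⋆-identityʳ : ∀ f n → (f ⋆ δ) n ≡ f n
⋆-identityʳ f zero    = *-identityʳ (f 0)
⋆-identityʳ f (suc n) = cong₂ _+_ (*-zeroʳ (f 0)) (⋆-identityʳ (f ∘ suc) n)

-- `f + g` is the constant sequence 1, and convolving with it produces partial sums.
⋆-complementˡ : ∀ (f g k : Seq) → (∀ i → f i + g i ≡ 1) →
                ∀ n → (f ⋆ k) n + (g ⋆ k) n ≡ cumul k n
⋆-complementˡ f g k f+g≡1 zero = begin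
  f 0 * k 0 + g 0 * k 0 ≡⟨ *-distribʳ-+ (k 0) (f 0) (g 0) ⟨
  (f 0 + g 0) * k 0     ≡⟨ cong (_* k 0) (f+g≡1 0) ⟩
  1 * k 0               ≡⟨ *-identityˡ (k 0) ⟩
  k 0                   ∎
  where open ≡-Reasoning
⋆-complementˡ f g k f+g≡1 (suc n) = begin
  f 0 * k (suc n) + F + (g 0 * k (suc n) + G) ≡⟨ rearrange (f 0) (k (suc n)) F (g 0) G ⟩
  (F + G) + (f 0 + g 0) * k (suc n)
    ≡⟨ cong₂ _+_ (⋆-complementˡ (f ∘ suc) (g ∘ suc) k (f+g≡1 ∘ suc) n) (cong (_* k (suc n)) (f+g≡1 0)) ⟩
  cumul k n + 1 * k (suc n)                   ≡⟨ cong (cumul k n +_) (*-identityˡ _) ⟩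
  cumul k n + k (suc n)                       ∎
  where
  open ≡-Reasoning
  F = ((f ∘ suc) ⋆ k) n
  G = ((g ∘ suc) ⋆ k) n
  rearrange : ∀ p q r s t → p * q + r + (s * q + t) ≡ (r + t) + (p + s) * q
  rearrange = solve-∀

-- As on the left, except that the recursion of `⋆` peels `cumul f` from the front, which is what
-- `cumul-suc` supplies.
⋆-complementʳ : ∀ (f g h : Seq) → (∀ i → g i + h i ≡ 1) →
                ∀ n → (f ⋆ g) n + (f ⋆ h) n ≡ cumul f n
⋆-complementʳ f g h g+h≡1 zero = begin
  f 0 * g 0 + f 0 * h 0 ≡⟨ *-distribˡ-+ (f 0) (g 0) (h 0) ⟨
  f 0 * (g 0 + h 0)     ≡⟨ cong (f 0 *_) (g+h≡1 0) ⟩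
  f 0 * 1               ≡⟨ *-identityʳ (f 0) ⟩
  f 0                   ∎
  where open ≡-Reasoning
⋆-complementʳ f g h g+h≡1 (suc n) = begin
  f 0 * g (suc n) + G + (f 0 * h (suc n) + H) ≡⟨ rearrange (f 0) (g (suc n)) G (h (suc n)) H ⟩
  f 0 * (g (suc n) + h (suc n)) + (G + H)
    ≡⟨ cong₂ _+_ (cong (f 0 *_) (g+h≡1 (suc n))) (⋆-complementʳ (f ∘ suc) g h g+h≡1 n) ⟩
  f 0 * 1 + cumul (f ∘ suc) n                 ≡⟨ cong (_+ cumul (f ∘ suc) n) (*-identityʳ _) ⟩
  f 0 + cumul (f ∘ suc) n                     ≡⟨ cumul-suc f n ⟨
  cumul f (suc n)                             ∎
  where
  open ≡-Reasoning
  G = ((f ∘ suc) ⋆ g) n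
  H = ((f ∘ suc) ⋆ h) n
  rearrange : ∀ p q r s t → p * q + r + (p * s + t) ≡ p * (q + s) + (r + t)
  rearrange = solve-∀

⋆-monoʳ-≤ : ∀ f {g g′ : Seq} → (∀ i → g i ≤ g′ i) → ∀ n → (f ⋆ g) n ≤ (f ⋆ g′) n
⋆-monoʳ-≤ f g≤g′ zero    = *-monoʳ-≤ (f 0) (g≤g′ 0)
⋆-monoʳ-≤ f g≤g′ (suc n) =
  +-mono-≤ (*-monoʳ-≤ (f 0) (g≤g′ (suc n))) (⋆-monoʳ-≤ (f ∘ suc) g≤g′ n)

⋆-monoʳ-< : ∀ f {g g′ : Seq} → f 0 ≡ 1 → (∀ i → g i < g′ i) → ∀ n → (f ⋆ g) n < (f ⋆ g′) n
⋆-monoʳ-< f f0≡1 g<g′ zero rewrite f0≡1 = *-monoʳ-< 1 (g<g′ 0)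
⋆-monoʳ-< f f0≡1 g<g′ (suc n) rewrite f0≡1 =
  +-mono-<-≤ (*-monoʳ-< 1 (g<g′ (suc n))) (⋆-monoʳ-≤ (f ∘ suc) (<⇒≤ ∘ g<g′) n)

-- The right side has one additional term, `f (suc n) * g 0`.
⋆-sucʳ-≤ : ∀ f g n → (f ⋆ (g ∘ suc)) n ≤ (f ⋆ g) (suc n)
⋆-sucʳ-≤ f g zero    = m≤m+n _ _
⋆-sucʳ-≤ f g (suc n) = +-monoʳ-≤ (f 0 * g (2 + n)) (⋆-sucʳ-≤ (f ∘ suc) g n)

⋆-increasing : ∀ f {g : Seq} → f 0 ≡ 1 → (∀ i → g i < g (suc i)) →
               ∀ n → (f ⋆ g) n < (f ⋆ g) (suc n)
⋆-increasing f {g} f0≡1 g-inc n = <-≤-trans (⋆-monoʳ-< f f0≡1 g-inc n) (⋆-sucʳ-≤ f g n)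

-- Each increment of `g` contributes at most `d` times its weight in `f`. The last term
-- `f (suc n) * g 0` has no counterpart at `n`; the hypothesis `g 0 ≤ d` absorbs it.
⋆-growth : ∀ f {g : Seq} {d} n → g 0 ≤ d → (∀ i → i ≤ n → g (suc i) ≤ g i + d) →
           (f ⋆ g) (suc n) ≤ (f ⋆ g) n + d * cumul f (suc n)
⋆-growth f {g} {d} zero g0≤d step = begin
  f 0 * g 1 + f 1 * g 0           ≤⟨ +-mono-≤ (*-monoʳ-≤ (f 0) (step 0 z≤n)) (*-monoʳ-≤ (f 1) g0≤d) ⟩
  f 0 * (g 0 + d) + f 1 * d       ≡⟨ rearrange (f 0) (g 0) d (f 1) ⟩
  f 0 * g 0 + d * (f 0 + f 1)     ∎
  where
  open ≤-Reasoning
  rearrange : ∀ p q r s → p * (q + r) + s * r ≡ p * q + r * (p + s)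
  rearrange = solve-∀
⋆-growth f {g} {d} (suc n) g0≤d step = begin
  f 0 * g (2 + n) + (f′ ⋆ g) (suc n)
    ≤⟨ +-mono-≤ (*-monoʳ-≤ (f 0) (step (suc n) ≤-refl))
                (⋆-growth f′ n g0≤d λ i i≤n → step i (m≤n⇒m≤1+n i≤n)) ⟩
  f 0 * (g (suc n) + d) + ((f′ ⋆ g) n + d * cumul f′ (suc n))
    ≡⟨ rearrange (f 0) (g (suc n)) d ((f′ ⋆ g) n) (cumul f′ (suc n)) ⟩
  f 0 * g (suc n) + (f′ ⋆ g) n + d * (f 0 + cumul f′ (suc n))
    ≡⟨ cong (λ s → f 0 * g (suc n) + (f′ ⋆ g) n + d * s) (cumul-suc f (suc n)) ⟨
  (f ⋆ g) (suc n) + d * cumul f (2 + n) ∎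
  where
  open ≤-Reasoning
  f′ = f ∘ suc
  rearrange : ∀ p q r s t → p * (q + r) + (s + r * t) ≡ p * q + s + r * (p + t)
  rearrange = solve-∀

-- Strict growth of the threefold convolution when the complement is sparse.

module Sparse {a b : Seq} (a+b≡1 : ∀ i → a i + b i ≡ 1)
              (sparse : ∀ n → cumul b n * (3 + cumul b n) ≤ n) where

  a≤1 : ∀ i → a i ≤ 1
  a≤1 i = m+n≤o⇒m≤o (a i) (≤-reflexive (a+b≡1 i))

  -- From `m` to `suc m`, the sum `a ⋆ a + b ⋆ a = cumul a` rises by at most 1, while `b ⋆ a` can
  -- fall by no more than its value at `m`, which is at most `cumul b m`.
  square-step : ∀ m → (a ⋆ a) (suc m) ≤ (a ⋆ a) m + (1 + cumul b (suc m))
  square-step m = +-cancelʳ-≤ ((b ⋆ a) (suc m)) _ _ (begin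
    (a ⋆ a) (suc m) + (b ⋆ a) (suc m)   ≡⟨ ⋆-complementˡ a b a a+b≡1 (suc m) ⟩
    cumul a m + a (suc m)               ≡⟨ cong (_+ a (suc m)) (⋆-complementˡ a b a a+b≡1 m) ⟨
    (a ⋆ a) m + (b ⋆ a) m + a (suc m)   ≤⟨ +-mono-≤ (+-monoʳ-≤ ((a ⋆ a) m) ba≤) (a≤1 (suc m)) ⟩
    (a ⋆ a) m + (ba′ + B′) + 1          ≡⟨ rearrange ((a ⋆ a) m) ba′ B′ ⟩
    (a ⋆ a) m + (1 + B′) + ba′          ∎)
    where
    open ≤-Reasoning
    ba′ = (b ⋆ a) (suc m)
    B′  = cumul b (suc m)
    rearrange : ∀ p q r → p + (q + r) + 1 ≡ p + (1 + r) + q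
    rearrange = solve-∀
    ba≤ : (b ⋆ a) m ≤ ba′ + B′
    ba≤ = begin
      (b ⋆ a) m               ≤⟨ m≤m+n _ _ ⟩
      (b ⋆ a) m + (b ⋆ b) m   ≡⟨ ⋆-complementʳ b a b a+b≡1 m ⟩
      cumul b m               ≤⟨ m≤m+n _ _ ⟩
      B′                      ≤⟨ m≤n+m B′ ba′ ⟩
      ba′ + B′                ∎

  -- Of the `n + 1` pairs with sum `n`, at most `cumul b n` have their first entry counted by `b`,
  -- and at most as many their second.
  square-large : ∀ n → n < (a ⋆ a) n + 2 * cumul b n
  square-large n = begin-strict
    n                                         <⟨ n<1+n n ⟩
    suc n                                     ≡⟨ cumul-complement a b a+b≡1 n ⟨
    cumul a n + cumul b n                     ≡⟨ cong (_+ cumul b n) (⋆-complementˡ a b a a+b≡1 n) ⟨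
    (a ⋆ a) n + (b ⋆ a) n + cumul b n         ≤⟨ +-monoˡ-≤ (cumul b n) (+-monoʳ-≤ ((a ⋆ a) n) ba≤B) ⟩
    (a ⋆ a) n + cumul b n + cumul b n         ≡⟨ rearrange ((a ⋆ a) n) (cumul b n) ⟩
    (a ⋆ a) n + 2 * cumul b n                 ∎
    where
    open ≤-Reasoning
    rearrange : ∀ p q → p + q + q ≡ p + 2 * q
    rearrange = solve-∀
    ba≤B : (b ⋆ a) n ≤ cumul b n
    ba≤B = ≤-trans (m≤m+n _ _) (≤-reflexive (⋆-complementʳ b a b a+b≡1 n))

  cumul-mono : ∀ {m n} → m ≤ n → cumul b m ≤ cumul b n
  cumul-mono {n = zero}  z≤n = ≤-refl
  cumul-mono {n = suc n} m≤1+n with m≤n⇒m<n∨m≡n m≤1+n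
  ... | inj₁ m<1+n = ≤-trans (cumul-mono (s≤s⁻¹ m<1+n)) (m≤m+n _ _)
  ... | inj₂ refl  = ≤-refl

  cube-increasing : ∀ n → (a ⋆ a ⋆ a) n < (a ⋆ a ⋆ a) (suc n)
  cube-increasing n = +-cancelʳ-< ((b ⋆ q) (suc n)) _ _ (begin-strict
    (a ⋆ q) n + (b ⋆ q) (suc n)               ≤⟨ +-monoʳ-≤ ((a ⋆ q) n) bq-growth ⟩
    (a ⋆ q) n + ((b ⋆ q) n + (1 + K) * K)     <⟨ +-monoʳ-< ((a ⋆ q) n) (+-monoʳ-< ((b ⋆ q) n) K-small) ⟩
    (a ⋆ q) n + ((b ⋆ q) n + q (suc n))       ≡⟨ +-assoc ((a ⋆ q) n) _ _ ⟨
    (a ⋆ q) n + (b ⋆ q) n + q (suc n)         ≡⟨ cong (_+ q (suc n)) (⋆-complementˡ a b q a+b≡1 n) ⟩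
    cumul q (suc n)                           ≡⟨ ⋆-complementˡ a b q a+b≡1 (suc n) ⟨
    (a ⋆ q) (suc n) + (b ⋆ q) (suc n)         ∎)
    where
    open ≤-Reasoning
    q = a ⋆ a
    K = cumul b (suc n)
    -- `K` is taken at the top index, so that the single slope `1 + K` serves every step up to `n`.
    bq-growth : (b ⋆ q) (suc n) ≤ (b ⋆ q) n + (1 + K) * K
    bq-growth = ⋆-growth b n
      (≤-trans (*-mono-≤ (a≤1 0) (a≤1 0)) (m≤m+n 1 K))
      (λ i i≤n → ≤-trans (square-step i)
        (+-monoʳ-≤ (q i) (s≤s (cumul-mono (s≤s i≤n)))))
    rearrange : ∀ k → (1 + k) * k + 2 * k ≡ k * (3 + k)
    rearrange = solve-∀
    -- The constant 3 of the sparsity bound originates here: `(1 + K) * K` and the loss `2 * K` from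
    -- `square-large` add up to `K * (3 + K)`.
    K-small : (1 + K) * K < q (suc n)
    K-small = +-cancelʳ-< (2 * K) _ _ (begin-strict
      (1 + K) * K + 2 * K   ≡⟨ rearrange K ⟩
      K * (3 + K)           ≤⟨ sparse (suc n) ⟩
      suc n                 <⟨ square-large (suc n) ⟩
      q (suc n) + 2 * K     ∎)

-- Counting functions as convolutions of indicators

χ : {P : Set} → Dec P → ℕ
χ P? = if does P? then 1 else 0

χ-yes : {P : Set} (P? : Dec P) → P → χ P? ≡ 1
χ-yes (yes _) _ = refl
χ-yes (no ¬p) p = contradiction p ¬p

χ-no : {P : Set} (P? : Dec P) → ¬ P → χ P? ≡ 0
χ-no (yes p) ¬p = contradiction p ¬p
χ-no (no _)  _  = refl

χ-cong : {P Q : Set} (P? : Dec P) (Q? : Dec Q) → (P → Q) → (Q → P) → χ P? ≡ χ Q?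
χ-cong (yes p) Q? P→Q Q→P = sym (χ-yes Q? (P→Q p))
χ-cong (no ¬p) Q? P→Q Q→P = sym (χ-no Q? (¬p ∘ Q→P))

χ+χ-¬ : {P : Set} (P? : Dec P) → χ P? + χ (¬? P?) ≡ 1
χ+χ-¬ (yes _) = refl
χ+χ-¬ (no _)  = refl

length-filter-∷ : {X : Set} {P : Pred X 0ℓ} (P? : Decidable P) → ∀ x xs →
                  length (filter P? (x ∷ xs)) ≡ χ (P? x) + length (filter P? xs)
length-filter-∷ P? x xs with P? x
... | yes _ = refl
... | no _  = refl

length-filter-++ : {X : Set} {P : Pred X 0ℓ} (P? : Decidable P) → ∀ xs ys →
                   length (filter P? (xs ++ ys)) ≡ length (filter P? xs) + length (filter P? ys)
length-filter-++ P? xs ys = trans (cong length (filter-++ P? xs ys)) (length-++ (filter P? xs))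

sum-applyUpTo-0 : ∀ (f : Seq) n → (∀ i → f i ≡ 0) → sum (applyUpTo f n) ≡ 0
sum-applyUpTo-0 f zero    f≡0 = refl
sum-applyUpTo-0 f (suc n) f≡0 = cong₂ _+_ (f≡0 0) (sum-applyUpTo-0 (f ∘ suc) n (f≡0 ∘ suc))

-- F i n plays the role of f i * g (n ∸ i), with value 0 when n < i.
sum-applyUpTo-⋆ : ∀ {f g : Seq} (F : ℕ → ℕ → ℕ) →
                  (∀ i m → F i (i + m) ≡ f i * g m) → (∀ i n → n < i → F i n ≡ 0) →
                  ∀ n N → n < N → sum (applyUpTo (λ i → F i n) N) ≡ (f ⋆ g) n
sum-applyUpTo-⋆ {f} {g} F F-⋆ F-0 zero (suc N) _ = begin
  F 0 0 + sum (applyUpTo (λ i → F (suc i) 0) N)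
    ≡⟨ cong₂ _+_ (F-⋆ 0 0) (sum-applyUpTo-0 _ N λ i → F-0 (suc i) 0 (s≤s z≤n)) ⟩
  f 0 * g 0 + 0 ≡⟨ +-identityʳ _ ⟩
  f 0 * g 0     ∎
  where open ≡-Reasoning
sum-applyUpTo-⋆ F F-⋆ F-0 (suc n) (suc N) (s≤s n<N) = cong₂ _+_
  (F-⋆ 0 (suc n))
  (sum-applyUpTo-⋆ (λ i m → F (suc i) (suc m)) (λ i m → F-⋆ (suc i) m)
    (λ i m m<i → F-0 (suc i) (suc m) (s≤s m<i)) n N n<N)

length-filter-product : {X Y Z : Set} {P : Pred Z 0ℓ} (P? : Decidable P) (_∙_ : X → Y → Z) →
                        (f : ℕ → X) → ∀ n ys →
                        length (filter P? (cartesianProductWith _∙_ (applyUpTo f n) ys)) ≡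
                        sum (applyUpTo (λ i → length (filter P? (map (f i ∙_) ys))) n)
length-filter-product P? _∙_ f zero    ys = refl
length-filter-product P? _∙_ f (suc n) ys = trans
  (length-filter-++ P? (map (f 0 ∙_) ys) _)
  (cong (length (filter P? (map (f 0 ∙_) ys)) +_) (length-filter-product P? _∙_ (f ∘ suc) n ys))

module _ {A : Pred ℕ 0ℓ} (A? : Decidable A) where

  member nonmember : Seq
  member    i = χ (A? i)
  nonmember i = χ (¬? (A? i))

  member+nonmember : ∀ i → member i + nonmember i ≡ 1
  member+nonmember i = χ+χ-¬ (A? i)

  power : ℕ → Seq
  power zero    = δ
  power (suc h) = member ⋆ power h

  count≡cumul : ∀ n → count A? n ≡ cumul member n
  count≡cumul zero    = trans (length-filter-∷ A? 0 []) (+-identityʳ _)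
  count≡cumul (suc n) = begin
    count A? (suc n)
      ≡⟨ cong (length ∘ filter A?) (upTo-∷ʳ (suc n)) ⟨
    length (filter A? (upTo (suc n) ++ suc n ∷ []))
      ≡⟨ length-filter-++ A? (upTo (suc n)) _ ⟩
    count A? n + length (filter A? (suc n ∷ []))
      ≡⟨ cong₂ _+_ (count≡cumul n) (trans (length-filter-∷ A? (suc n) []) (+-identityʳ _)) ⟩
    cumul member n + member (suc n) ∎
    where open ≡-Reasoning

  -- The candidate list is independent of the target, unlike in `R`, whose search range grows with
  -- `n`.
  repsIn : (h : ℕ) → List (Vec ℕ h) → Seq
  repsIn h vs n = length (filter (isRep? A? h n) vs)

  -- Prepending a member `i` shifts the sum by `i`, which cancels; for a nonmember both sides
  -- vanish.
  χ-isRep-∷ : ∀ h i m v →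
              χ (isRep? A? (suc h) (i + m) (i Vec.∷ v)) ≡ member i * χ (isRep? A? h m v)
  χ-isRep-∷ h i m v = by-cases (A? i)
    where
    extended? = isRep? A? (suc h) (i + m) (i Vec.∷ v)
    rep?      = isRep? A? h m v
    by-cases : Dec (A i) → χ extended? ≡ member i * χ rep?
    by-cases (yes Ai) = begin
      χ extended?         ≡⟨ χ-cong extended? rep?
                               (λ { (_ ∷ Av , s) → Av , +-cancelˡ-≡ i _ _ s })
                               (λ { (Av , s) → Ai ∷ Av , cong (i +_) s }) ⟩
      χ rep?              ≡⟨ *-identityˡ _ ⟨
      1 * χ rep?          ≡⟨ cong (_* χ rep?) (χ-yes (A? i) Ai) ⟨
      member i * χ rep?   ∎
      where open ≡-Reasoning
    by-cases (no ¬Ai) = trans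
      (χ-no extended? λ { (Ai ∷ _ , _) → ¬Ai Ai })
      (cong (_* χ rep?) (sym (χ-no (A? i) ¬Ai)))

  repsIn-∷ : ∀ h i m vs → repsIn (suc h) (map (i Vec.∷_) vs) (i + m) ≡ member i * repsIn h vs m
  repsIn-∷ h i m []       = sym (*-zeroʳ (member i))
  repsIn-∷ h i m (v ∷ vs) = begin
    repsIn (suc h) (map (i Vec.∷_) (v ∷ vs)) (i + m)
      ≡⟨ length-filter-∷ (isRep? A? (suc h) (i + m)) (i Vec.∷ v) _ ⟩
    χ (isRep? A? (suc h) (i + m) (i Vec.∷ v)) + repsIn (suc h) (map (i Vec.∷_) vs) (i + m)
      ≡⟨ cong₂ _+_ (χ-isRep-∷ h i m v) (repsIn-∷ h i m vs) ⟩
    member i * χ (isRep? A? h m v) + member i * repsIn h vs m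
      ≡⟨ *-distribˡ-+ (member i) _ _ ⟨
    member i * (χ (isRep? A? h m v) + repsIn h vs m)
      ≡⟨ cong (member i *_) (length-filter-∷ (isRep? A? h m) v vs) ⟨
    member i * repsIn h (v ∷ vs) m ∎
    where open ≡-Reasoning

  repsIn-∷-0 : ∀ h i n vs → n < i → repsIn (suc h) (map (i Vec.∷_) vs) n ≡ 0
  repsIn-∷-0 h i n []       n<i = refl
  repsIn-∷-0 h i n (v ∷ vs) n<i = trans
    (length-filter-∷ (isRep? A? (suc h) n) (i Vec.∷ v) _)
    (cong₂ _+_
      (χ-no (isRep? A? (suc h) n (i Vec.∷ v))
        λ { (_ , s) → <⇒≱ n<i (≤-trans (m≤m+n i _) (≤-reflexive s)) })
      (repsIn-∷-0 h i n vs n<i))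

  -- A bound `N` fixed throughout the induction lets all smaller targets be counted over the same
  -- list; `R` is the instance `N = suc n`.
  repsIn-tuples : ∀ h n N → n < N → repsIn h (tuples h (upTo N)) n ≡ power h n
  repsIn-tuples zero    zero    N n<N = refl
  repsIn-tuples zero    (suc n) N n<N = refl
  repsIn-tuples (suc h) n       N n<N = begin
    repsIn (suc h) (cartesianProductWith Vec._∷_ (upTo N) vs) n
      ≡⟨ length-filter-product (isRep? A? (suc h) n) Vec._∷_ _ N vs ⟩
    sum (applyUpTo (λ i → repsIn (suc h) (map (i Vec.∷_) vs) n) N)
      ≡⟨ sum-applyUpTo-⋆ (λ i → repsIn (suc h) (map (i Vec.∷_) vs))
           (λ i m → repsIn-∷ h i m vs) (λ i m → repsIn-∷-0 h i m vs) n N n<N ⟩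
    (member ⋆ repsIn h vs) n
      ≡⟨ ⋆-congʳ member n (λ i i≤n → repsIn-tuples h i N (≤-<-trans i≤n n<N)) ⟩
    (member ⋆ power h) n ∎
    where
    open ≡-Reasoning
    vs = tuples h (upTo N)

  R≡power : ∀ h n → R A? h n ≡ power h n
  R≡power h n = repsIn-tuples h n (suc n) ≤-refl

  module _ (0∈A : A 0) (sparse : ∀ n → cumul nonmember n * (3 + cumul nonmember n) ≤ n) where

    open Sparse {member} {nonmember} member+nonmember sparse

    power-3 : ∀ n → power 3 n ≡ (member ⋆ member ⋆ member) n
    power-3 n = ⋆-congʳ member n λ i _ → ⋆-congʳ member i λ j _ → ⋆-identityʳ member j

    power-increasing : ∀ k n → power (k + 3) n < power (k + 3) (suc n)
    power-increasing zero    n = subst₂ _<_ (sym (power-3 n)) (sym (power-3 (suc n))) (cube-increasing n)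
    power-increasing (suc k) = ⋆-increasing member (χ-yes (A? 0) 0∈A) (power-increasing k)

    R-increasing : ∀ h → 3 ≤ h → ∀ n → R A? h n < R A? h (n + 1)
    R-increasing h 3≤h n = subst₂ _<_
      (sym (R≡power h n))
      (trans (sym (R≡power h (suc n))) (cong (R A? h) (+-comm 1 n)))
      (subst (λ k → power k n < power k (suc n)) (m∸n+n≡m 3≤h) (power-increasing (h ∸ 3) n))

-- Density

∣m⊖n∣≤ : ∀ {m n k} → m ≤ n + k → n ≤ m + k → ℤ.∣ m ℤ.⊖ n ∣ ≤ k
∣m⊖n∣≤ {m} {n} {k} m≤n+k n≤m+k with ≤-total m n
... | inj₁ m≤n = subst (_≤ k) (sym (ℤₚ.∣⊖∣-≤ m≤n)) (m≤n+o⇒m∸n≤o n m n≤m+k)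
... | inj₂ n≤m = subst (_≤ k)
  (sym (trans (ℤₚ.∣m⊖n∣≡∣n⊖m∣ m n) (ℤₚ.∣⊖∣-≤ n≤m))) (m≤n+o⇒m∸n≤o m n m≤n+k)

-- The distance is `∣m - n∣ / n ≤ k / n`. With `d` the denominator of `ε`, the last hypothesis gives
-- `k / n < 1 / d`, and `1 / d ≤ ε` because a positive numerator is at least 1.
∣m/n-1∣<ε : ∀ {m n k ε} .{{_ : NonZero n}} → m ≤ n + k → n ≤ m + k →
            ℚ.0ℚ ℚ.< ε → k * ℚ.↧ₙ ε < n → ℚ.∣ ℤ.+ m ℚ./ n ℚ.- 1ℚ ∣ ℚ.< ε
∣m/n-1∣<ε {ε = ℚ.mkℚ (ℤ.+ zero) _ _} _ _ (ℚ.*<* (ℤ.+<+ ())) _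
∣m/n-1∣<ε {ε = ℚ.mkℚ ℤ.-[1+ _ ] _ _} _ _ (ℚ.*<* ()) _
∣m/n-1∣<ε {m} {n@(suc n-1)} {k} {ε@(ℚ.mkℚ (ℤ.+ suc p-1) d-1 _)} m≤n+k n≤m+k _ kd<n =
  ℚₚ.toℚᵘ-cancel-< (ℚᵘₚ.<-respˡ-≃ (ℚᵘₚ.≃-sym unnormalise) (ℚᵘ.*<* (begin-strict
    ℤ.+ ℤ.∣ x ∣ ℤ.* ℤ.+ suc d-1       ≡⟨ ℤₚ.pos-* ℤ.∣ x ∣ (suc d-1) ⟨
    ℤ.+ (ℤ.∣ x ∣ * suc d-1)           <⟨ ℤ.+<+ bound ⟩
    ℤ.+ (suc p-1 * (n * 1))           ≡⟨ ℤₚ.pos-* (suc p-1) (n * 1) ⟩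
    ℤ.+ suc p-1 ℤ.* ℤ.+ (n * 1)       ∎)))
  where
  open ℤₚ.≤-Reasoning
  q = ℤ.+ m ℚ./ n
  qᵘ-1 = mkℚᵘ (ℤ.+ m) n-1 ℚᵘ.- ℚᵘ.1ℚᵘ
  -- The numerator of `qᵘ-1` as unnormalised subtraction produces it, over the denominator `n * 1`.
  x = ℤ.+ m ℤ.* ℤ.+ 1 ℤ.+ ℤ.-[1+ 0 ] ℤ.* ℤ.+ n
  -- Dividing out the gcd does not compute for variable `m` and `n`, so the estimate is made on the
  -- unnormalised fraction.
  unnormalise : ℚ.toℚᵘ ℚ.∣ q ℚ.- 1ℚ ∣ ℚᵘ.≃ ℚᵘ.∣ qᵘ-1 ∣
  unnormalise = ℚᵘₚ.≃-trans (ℚₚ.toℚᵘ-homo-∣-∣ (q ℚ.- 1ℚ)) (ℚᵘₚ.∣-∣-cong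
    (ℚᵘₚ.≃-trans (ℚₚ.toℚᵘ-homo-+ q (ℚ.- 1ℚ))
      (ℚᵘₚ.+-congˡ (ℚᵘ.- ℚᵘ.1ℚᵘ) (ℚₚ.toℚᵘ-fromℚᵘ (mkℚᵘ (ℤ.+ m) n-1)))))
  x≡m⊖n : x ≡ m ℤ.⊖ n
  x≡m⊖n = trans
    (cong₂ ℤ._+_ (ℤₚ.*-identityʳ (ℤ.+ m)) (ℤₚ.-1*i≡-i (ℤ.+ n)))
    (ℤₚ.m-n≡m⊖n m n)
  bound : ℤ.∣ x ∣ * suc d-1 < suc p-1 * (n * 1)
  bound = ≤-<-trans
    (*-monoˡ-≤ (suc d-1) (subst (λ i → ℤ.∣ i ∣ ≤ k) (sym x≡m⊖n) (∣m⊖n∣≤ m≤n+k n≤m+k)))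
    (<-≤-trans kd<n (≤-trans (≤-reflexive (sym (*-identityʳ n))) (m≤m+n (n * 1) _)))

module _ {A : Pred ℕ 0ℓ} (A? : Decidable A)
         (sparse : ∀ n → cumul (nonmember A?) n * (3 + cumul (nonmember A?) n) ≤ n) where

  -- As count and gaps add up to `n + 1`, the count differs from `n` by at most `1 + gaps n`, which
  -- sparsity keeps to the order of the square root of `n`.
  density→1 : HasLimit (density A?) 1ℚ
  density→1 ε 0<ε = suc (d * d) , λ n d²<n →
    ∣m/n-1∣<ε {k = 1 + gaps n} (count≤ n) (≤count n) 0<ε (gaps-small n d²<n)
    where
    open ≤-Reasoning
    d = ℚ.↧ₙ ε
    gaps = cumul (nonmember A?)
    count+gaps : ∀ n → count A? n + gaps n ≡ suc n
    count+gaps n = trans (cong (_+ gaps n) (count≡cumul A? n))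
      (cumul-complement (member A?) (nonmember A?) (member+nonmember A?) n)
    count≤ : ∀ n → count A? n ≤ n + (1 + gaps n)
    count≤ n = begin
      count A? n              ≤⟨ m≤m+n _ _ ⟩
      count A? n + gaps n     ≡⟨ count+gaps n ⟩
      suc n                   ≤⟨ m≤m+n _ _ ⟩
      suc n + gaps n          ≡⟨ +-suc n (gaps n) ⟨
      n + (1 + gaps n)        ∎
    ≤count : ∀ n → n ≤ count A? n + (1 + gaps n)
    ≤count n = begin
      n                         ≤⟨ m≤n+m n 2 ⟩
      suc (suc n)               ≡⟨ cong suc (count+gaps n) ⟨
      suc (count A? n + gaps n) ≡⟨ +-suc (count A? n) (gaps n) ⟨
      count A? n + (1 + gaps n) ∎
    gaps-small : ∀ n → d * d < n → (1 + gaps n) * d < n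
    -- With fewer than `d` gaps the threshold `d * d < n` suffices, which explains its choice;
    -- otherwise the factor `d` is bounded by `gaps n` and sparsity applies.
    gaps-small n d²<n with <-≤-connex (gaps n) d
    ... | inj₁ gaps<d = ≤-<-trans (*-monoˡ-≤ d gaps<d) d²<n
    ... | inj₂ d≤gaps = begin-strict
      (1 + gaps n) * d          <⟨ *-monoˡ-< d (m<n+m (1 + gaps n) {2} (s≤s z≤n)) ⟩
      (3 + gaps n) * d          ≤⟨ *-monoʳ-≤ (3 + gaps n) d≤gaps ⟩
      (3 + gaps n) * gaps n     ≡⟨ *-comm (3 + gaps n) (gaps n) ⟩
      gaps n * (3 + gaps n)     ≤⟨ sparse n ⟩
      n                         ∎

-- The set of missing numbers

-- This polynomial makes sparsity immediate: the `k`-th missing number is `gap k`, so having `k` of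
-- them up to `n` forces `gap k ≤ n`. Only positive `k` give missing numbers, which keeps 0 in the
-- set.
gap : Seq
gap k = k * (3 + k)

gap-mono-≤ : ∀ {j k} → j ≤ k → gap j ≤ gap k
gap-mono-≤ j≤k = *-mono-≤ j≤k (+-monoʳ-≤ 3 j≤k)

gap-suc-< : ∀ k → gap k < gap (suc k)
gap-suc-< k = *-mono-< (n<1+n k) (n<1+n (3 + k))

n<gap-suc : ∀ n → n < gap (suc n)
n<gap-suc n = m≤m*n (suc n) (4 + n)

-- The bound j < n is automatic, and makes membership decidable by search.
IsGap : Pred ℕ 0ℓ
IsGap n = ∃[ j ] j < n × gap (suc j) ≡ n

Full : Pred ℕ 0ℓ
Full = ∁ IsGap

Full? : Decidable Full
Full? n = ¬? (anyUpTo? (λ j → gap (suc j) ≟ n) n)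

-- The two bounds locate `n` between consecutive values of `gap`; the upper one decides whether
-- `suc n` is the next missing number.
cumul-gaps : ∀ n → ∃[ k ] cumul (nonmember Full?) n ≡ k × gap k ≤ n × n < gap (suc k)
cumul-gaps zero = 0 , refl , z≤n , s≤s z≤n
cumul-gaps (suc n) with cumul-gaps n
... | k , eq , gap≤n , n<gap with m≤n⇒m<n∨m≡n n<gap
...   | inj₁ 1+n<gap = k , trans (cong₂ _+_ eq (χ-no (¬? (Full? (suc n))) full)) (+-identityʳ k)
                     , m≤n⇒m≤1+n gap≤n , 1+n<gap
  where
  -- `suc n` lies strictly between `gap k` and `gap (suc k)`, so no `j` can hit it. The double
  -- negation arises because `nonmember` tests `¬ Full`.
  full : ¬ ¬ Full (suc n)
  full ¬Full = ¬Full λ (j , _ , gap≡) → case <-≤-connex j k of λ where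
    (inj₁ j<k) → <⇒≱ (n<1+n n) (≤-trans (≤-reflexive (sym gap≡)) (≤-trans (gap-mono-≤ j<k) gap≤n))
    (inj₂ k≤j) → <⇒≱ 1+n<gap (≤-trans (gap-mono-≤ (s≤s k≤j)) (≤-reflexive gap≡))
...   | inj₂ 1+n≡gap = suc k
                     , trans (cong₂ _+_ eq (χ-yes (¬? (Full? (suc n))) λ full → full isGap)) (+-comm k 1)
                     , ≤-reflexive (sym 1+n≡gap)
                     , ≤-<-trans (≤-reflexive 1+n≡gap) (gap-suc-< (suc k))
  where
  isGap : IsGap (suc n)
  isGap = k , subst (k <_) (sym 1+n≡gap) (n<gap-suc k) , sym 1+n≡gap

gaps-sparse : ∀ n → cumul (nonmember Full?) n * (3 + cumul (nonmember Full?) n) ≤ n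
gaps-sparse n with cumul-gaps n
... | _ , refl , gap≤n , _ = gap≤n

infinitely-many-gaps : Infinite (∁ Full)
infinitely-many-gaps m =
  gap (suc m) , <⇒≤ (n<gap-suc m) , λ full → full (m , n<gap-suc m , refl)

theorem1p2 : Σ[ C ∈ Pred ℕ 0ℓ ] Σ[ C? ∈ Decidable C ]
    ( Infinite (∁ C)
    × HasLimit (density C?) 1ℚ
    × (∀ h → 3 ≤ h → ∀ n → R C? h n < R C? h (n + 1)) )
theorem1p2 = Full , Full? , infinitely-many-gaps , density→1 Full? gaps-sparse
  -- 0 belongs to `Full` because no `j < 0` exists.
  , R-increasing Full? (λ { (_ , () , _) }) gaps-sparse
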